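{- For every finite graph $G$ with maximum degree $\Delta\ge1$, $\pi_{\operatorname{T_wch}}(G)\le 6\Delta$.
   Context: A sequence $s_1\ldots s_{2k}$ ($k\ge1$) is a square if $s_i=s_{i+k}$ for all $i$; a sequence is non-repetitive if it has no consecutive subsequence that is a square. The elements of a graph are its vertices and edges. A mixed-path is an alternating sequence of vertices and edges in which consecutive elements are incident, and no element appears twice. A coloring of all vertices and edges of $G$ is a weak total Thue coloring if the color sequence of every mixed-path is non-repetitive. A list assignment $L$ assigns to each vertex and each edge a set of colors. $\pi_{\operatorname{T_wch}}(G)$ is the smallest $l$ such that for every list assignment with all lists of size at least $l$ there is a weak total Thue coloring in which every element $x$ receives a color from $L(x)$. -}

module Defs where

open import Data.Nat using (ℕ; _≤_; _*_)
open import Data.Fin using (Fin) renaming (_<_ to _<ᶠ_)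
open import Data.Fin.Properties using (_≟_)
open import Data.Bool using (Bool; true; false)
open import Data.List using (List; []; _∷_; _++_; length; map; filter; allFin)
open import Data.List.Relation.Unary.All using (All)
open import Data.List.Relation.Unary.Linked using (Linked)
open import Data.List.Relation.Unary.Unique.Propositional using (Unique)
open import Data.List.Membership.Propositional using (_∈_)
open import Data.Product using (Σ; ∃; _×_; _,_)
open import Data.Sum using (_⊎_)
open import Data.Unit using (⊤)
open import Data.Empty using (⊥)
open import Relation.Nullary using (¬_)
open import Relation.Binary.PropositionalEquality using (_≡_; _≢_)
import Data.Bool.Properties as BP

Square : List ℕ → Set
Square s = Σ (List ℕ) λ ys → ys ≢ [] × s ≡ ys ++ ys

NonRepetitive : List ℕ → Set
NonRepetitive s = ∀ (pre w suf : List ℕ) → s ≡ pre ++ w ++ suf → ¬ Square w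

record Graph (n : ℕ) : Set where
  field
    adj   : Fin n → Fin n → Bool
    sym   : ∀ u v → adj u v ≡ adj v u
    irrfl : ∀ v → adj v v ≡ false

open Graph public

degree : ∀ {n} → Graph n → Fin n → ℕ
degree G v = length (filter (λ u → adj G v u BP.≟ true) (allFin _))

MaxDegree : ∀ {n} → Graph n → ℕ → Set
MaxDegree G Δ = (∀ v → degree G v ≤ Δ) × ∃ λ v → degree G v ≡ Δ

-- Candidate elements; an edge {u,v} is represented by  edg u v  with u < v.
data Elem (n : ℕ) : Set where
  vtx : Fin n → Elem n
  edg : Fin n → Fin n → Elem n

IsElem : ∀ {n} → Graph n → Elem n → Set
IsElem G (vtx v)   = ⊤
IsElem G (edg u v) = u <ᶠ v × adj G u v ≡ true

Incident : ∀ {n} → Elem n → Elem n → Set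
Incident (vtx v)   (edg a b) = v ≡ a ⊎ v ≡ b
Incident (edg a b) (vtx v)   = v ≡ a ⊎ v ≡ b
Incident _         _         = ⊥

-- A mixed-path: sequence of elements of G, consecutive ones incident
-- (hence alternating vertices and edges), no element repeated.
MixedPath : ∀ {n} → Graph n → List (Elem n) → Set
MixedPath G p = All (IsElem G) p × Linked Incident p × Unique p

WeakTotalThue : ∀ {n} → Graph n → (Elem n → ℕ) → Set
WeakTotalThue G c = ∀ p → MixedPath G p → NonRepetitive (map c p)

ListAssignmentOfSize : ∀ {n} → Graph n → ℕ → (Elem n → List ℕ) → Set
ListAssignmentOfSize G l L = ∀ x → IsElem G x → Unique (L x) × l ≤ length (L x)

FromLists : ∀ {n} → Graph n → (Elem n → List ℕ) → (Elem n → ℕ) → Set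
FromLists G L c = ∀ x → IsElem G x → c x ∈ L x

-- π_{T_wch}(G) ≤ l  (the defining property, monotone in l)
WeakTotalThueChoosable : ∀ {n} → Graph n → ℕ → Set
WeakTotalThueChoosable G l =
  ∀ L → ListAssignmentOfSize G l L →
    Σ (Elem _ → ℕ) λ c → FromLists G L c × WeakTotalThue G c

{-# OPTIONS --safe #-}

-- Rosenfeld's counting argument. Let C(S) be the number of good list colourings of a set S of elements.
-- By induction on |S|, adding an element x multiplies C by at least 2Δ. Of the at least 6Δ C(S) ways to
-- extend a colouring, the spoiled ones repeat on a mixed path of 2k + 2 elements through x. There are at
-- most (k + 1) max(Δ, 2) (Δ − 1)^k such paths: orient each so that an even number of elements precedes x.
-- Such a repetition determines the colours of the half containing x, so by the induction hypothesis each
-- path spoils at most C(S) / (2Δ)^k extensions, and Σ (k + 1) Δ / 2^k = 4Δ. (For Δ = 1 only k = 0 counts.)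
module Submission where

open import Defs hiding (sym)
open import Data.Nat using (ℕ; zero; suc; _+_; _*_; _∸_; _^_; _⊔_; _≤_; _<_; z≤n; s≤s)
open import Data.Nat.ListAction using (sum)
open import Data.Nat.Properties
open import Data.Nat.Solver using (module +-*-Solver)
open import Data.Bool using (true; if_then_else_)
import Data.Bool.Properties as Bool
open import Data.Fin using (Fin; zero; suc; _↑ˡ_; _↑ʳ_; splitAt; combine; remQuot)
import Data.Fin.Properties as Fin
open import Data.List using (List; []; _∷_; [_]; _++_; _ʳ++_; length; map; filter; concatMap; reverse; take; drop; downFrom; allFin; cartesianProduct; cartesianProductWith)
open import Data.List.Properties using (length-++; length-map; length-reverse; length-tabulate; length-downFrom; reverse-++; reverse-map; reverse-involutive; unfold-reverse; ++-assoc; map-cong-local; map-∘; map-id; map-++; filter-notAll; ∷-injectiveˡ; ∷-injectiveʳ; ≡-dec)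
open import Data.List.Membership.Propositional using (_∈_; _∉_; lose; find)
open import Data.List.Membership.Propositional.Properties
open import Data.List.Relation.Unary.All as All using (All; []; _∷_; all?)
import Data.List.Relation.Unary.All.Properties as All
open import Data.List.Relation.Unary.Any using (Any; here; there; any?)
open import Data.List.Relation.Unary.AllPairs using ([]; _∷_)
open import Data.List.Relation.Unary.Linked as Linked using (Linked; []; [-]; _∷_; linked?)
open import Data.List.Relation.Unary.Unique.Propositional using (Unique)
import Data.List.Relation.Unary.Unique.Propositional.Properties as Unique
open import Data.List.Relation.Binary.Subset.Propositional using (_⊆_)
open import Data.List.Relation.Binary.Permutation.Propositional using (_↭_; ↭-sym; ↭⇒↭ₛ)
import Data.List.Relation.Binary.Permutation.Propositional.Properties as Perm
import Data.List.Relation.Binary.Permutation.Setoid.Properties as PermSetoid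
open import Data.Vec using (Vec; []; _∷_; lookup; tabulate; _[_]≔_)
open import Data.Vec.Properties using (∷-injective; lookup∘tabulate; tabulate∘lookup; tabulate-cong; lookup∘updateAt; lookup∘updateAt′)
open import Data.Product using (∃-syntax; _×_; _,_; proj₁; proj₂; uncurry)
open import Data.Sum using (_⊎_; inj₁; inj₂; [_,_]′)
open import Data.Unit using (tt)
open import Data.Empty using (⊥-elim)
open import Function using (_∘_; id; case_of_)
open import Relation.Nullary using (¬_; Dec; yes; no; contradiction; ¬?)
open import Relation.Nullary.Decidable using (_×-dec_; _⊎-dec_; map′; does)
open import Relation.Unary using (Decidable)
open import Relation.Binary.PropositionalEquality using (_≡_; _≢_; refl; sym; trans; cong; cong₂; subst; subst₂; setoid; module ≡-Reasoning)

-- Duplicate-free lists, injections and lengths.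

Unique-resp-↭ : ∀ {A : Set} {xs ys : List A} → xs ↭ ys → Unique xs → Unique ys
Unique-resp-↭ {A} p = PermSetoid.Unique-resp-↭ (setoid A) (↭⇒↭ₛ p)

Unique-++-disjoint : ∀ {A : Set} (xs : List A) {ys a} → Unique (xs ++ ys) → a ∈ xs → a ∉ ys
Unique-++-disjoint (_ ∷ xs) (x∉ ∷ _) (here refl) a∈ys = All.lookup x∉ (∈-++⁺ʳ xs a∈ys) refl
Unique-++-disjoint (_ ∷ xs) (_ ∷ u) (there a∈xs) a∈ys = Unique-++-disjoint xs u a∈xs a∈ys

Unique-++⁻ˡ : ∀ {A : Set} (xs : List A) {ys} → Unique (xs ++ ys) → Unique xs
Unique-++⁻ˡ [] _ = []
Unique-++⁻ˡ (_ ∷ xs) (x∉ ∷ u) = All.++⁻ˡ xs x∉ ∷ Unique-++⁻ˡ xs u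

Unique-++⁻ʳ : ∀ {A : Set} (xs : List A) {ys} → Unique (xs ++ ys) → Unique ys
Unique-++⁻ʳ [] u = u
Unique-++⁻ʳ (_ ∷ xs) (_ ∷ u) = Unique-++⁻ʳ xs u

-- Each step deletes the image of the head from `ys`; injectivity keeps the other images in what is
-- left. It is asked only on `xs`, since the maps used below are injective only on lists of
-- admissible colourings.
injection-length : ∀ {A B : Set} {xs : List A} (ys : List B) (f : A → B) → Unique xs →
  (∀ {x} → x ∈ xs → f x ∈ ys) →
  (∀ {x y} → x ∈ xs → y ∈ xs → f x ≡ f y → x ≡ y) →
  length xs ≤ length ys
injection-length {xs = []} ys f u f∈ inj = z≤n
injection-length {xs = x ∷ xs} ys f (x∉ ∷ u) f∈ inj with ∈-∃++ (f∈ (here refl))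
... | ys₁ , ys₂ , refl = begin
    suc (length xs)                    ≤⟨ s≤s (injection-length (ys₁ ++ ys₂) f u f∈′ (λ p q → inj (there p) (there q))) ⟩
    length (f x ∷ ys₁ ++ ys₂)          ≡⟨ sym (Perm.↭-length (Perm.shift (f x) ys₁ ys₂)) ⟩
    length (ys₁ ++ [ f x ] ++ ys₂)     ∎
  where
  open ≤-Reasoning
  f∈′ : ∀ {z} → z ∈ xs → f z ∈ ys₁ ++ ys₂
  f∈′ z∈ with Perm.∈-resp-↭ (Perm.shift (f x) ys₁ ys₂) (f∈ (there z∈))
  ... | here eq = ⊥-elim (All.lookup x∉ z∈ (sym (inj (there z∈) (here refl) eq)))
  ... | there r = r

Unique-⊆-length : ∀ {A : Set} {xs ys : List A} → Unique xs → xs ⊆ ys → length xs ≤ length ys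
Unique-⊆-length u s = injection-length _ id u s (λ _ _ → id)

length-concatMap : ∀ {A B : Set} (f : A → List B) xs → length (concatMap f xs) ≡ sum (map (length ∘ f) xs)
length-concatMap f [] = refl
length-concatMap f (x ∷ xs) = trans (length-++ (f x)) (cong (length (f x) +_) (length-concatMap f xs))

-- The multiplied form of bounding every term by `c / b`, which keeps division out of the natural
-- numbers.
sum-scaled-≤ : ∀ {A : Set} (f : A → ℕ) {b c} xs → (∀ {x} → x ∈ xs → f x * b ≤ c) → sum (map f xs) * b ≤ length xs * c
sum-scaled-≤ f [] _ = z≤n
sum-scaled-≤ f {b} {c} (x ∷ xs) h =
  subst (_≤ suc (length xs) * c) (sym (*-distribʳ-+ b (f x) _)) (+-mono-≤ (h (here refl)) (sum-scaled-≤ f xs (h ∘ there)))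

length-cartesianProductWith : ∀ {A B C : Set} (f : A → B → C) xs ys →
  length (cartesianProductWith f xs ys) ≡ length xs * length ys
length-cartesianProductWith f [] ys = refl
length-cartesianProductWith f (x ∷ xs) ys = trans (length-++ (map (f x) ys))
  (cong₂ _+_ (length-map (f x) ys) (length-cartesianProductWith f xs ys))

length-Fin-≤ : ∀ {N} {xs : List (Fin N)} → Unique xs → length xs ≤ N
length-Fin-≤ {N} {xs} u = subst (length xs ≤_) (length-tabulate (id {A = Fin N})) (Unique-⊆-length u (λ {i} _ → ∈-allFin i))

-- The product of the lists `f i`. Colourings are counted as vectors rather than functions, so that
-- pointwise agreement gives equality (`lookup-ext`).
vectors : ∀ {m} → (Fin m → List ℕ) → List (Vec ℕ m)
vectors {zero}  f = [ [] ]
vectors {suc m} f = cartesianProductWith _∷_ (f zero) (vectors (f ∘ suc))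

∈-vectors⁺ : ∀ {m} {f : Fin m → List ℕ} v → (∀ i → lookup v i ∈ f i) → v ∈ vectors f
∈-vectors⁺ []      h = here refl
∈-vectors⁺ (a ∷ v) h = ∈-cartesianProductWith⁺ _∷_ (h zero) (∈-vectors⁺ v (h ∘ suc))

∈-vectors⁻ : ∀ {m} {f : Fin m → List ℕ} v → v ∈ vectors f → ∀ i → lookup v i ∈ f i
∈-vectors⁻ {suc m} {f} v v∈ i with ∈-cartesianProductWith⁻ _∷_ (f zero) (vectors (f ∘ suc)) v∈
∈-vectors⁻ {suc m} {f} v v∈ zero    | a , w , a∈ , w∈ , refl = a∈
∈-vectors⁻ {suc m} {f} v v∈ (suc i) | a , w , a∈ , w∈ , refl = ∈-vectors⁻ w w∈ i

vectors-unique : ∀ {m} {f : Fin m → List ℕ} → (∀ i → Unique (f i)) → Unique (vectors f)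
vectors-unique {zero}  h = [] ∷ []
vectors-unique {suc m} h = Unique.cartesianProductWith⁺ _∷_ ∷-injective (h zero) (vectors-unique (h ∘ suc))

lookup-ext : ∀ {m} (v w : Vec ℕ m) → (∀ i → lookup v i ≡ lookup w i) → v ≡ w
lookup-ext v w h = trans (sym (tabulate∘lookup v)) (trans (tabulate-cong h) (tabulate∘lookup w))

map-≡-∈ : ∀ {A B : Set} {f g : A → B} {xs a} → map f xs ≡ map g xs → a ∈ xs → f a ≡ g a
map-≡-∈ {xs = x ∷ xs} eq (here refl) = ∷-injectiveˡ eq
map-≡-∈ {xs = x ∷ xs} eq (there a∈)  = map-≡-∈ (∷-injectiveʳ eq) a∈

-- The counting argument for an abstract family of paths.

module Counting {N : ℕ} (V : Fin N → Set) (L : Fin N → List ℕ)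
  (Path : List (Fin N) → Set) (path? : Decidable Path)
  (path-unique : ∀ {P} → Path P → Unique P)
  (path-reverse : ∀ {P} → Path P → Path (reverse P))
  -- Candidates for the two halves, of `k + 1` elements each, of a path through `x`. Covering each
  -- path in one of its two directions suffices, because a repetition survives reversal.
  (pairs : Fin N → ℕ → List (List (Fin N) × List (Fin N)))
  (pairs-cover : ∀ {x} k A B → length A ≡ suc k → length B ≡ suc k → Path (A ++ B) → x ∈ A ++ B →
    (A , B) ∈ pairs x k ⊎ (reverse B , reverse A) ∈ pairs x k)
  (β l : ℕ) (w : ℕ → ℕ) (1≤β : 1 ≤ β)
  (L-unique : ∀ {x} → V x → Unique (L x)) (L-size : ∀ {x} → V x → l ≤ length (L x))
  (pairs-size : ∀ {x} → V x → ∀ k → length (pairs x k) ≤ w k)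
  -- `s k` stands for the number of extensions spoiled by halves of `k + 1` elements. Even if each
  -- is as large as `w k * C / β ^ k`, at least `β * C` of the `l * C` extensions must remain.
  (budget : ∀ C s → (∀ k → s k * β ^ k ≤ w k * C) → β * C + sum (map s (downFrom N)) ≤ l * C)
  where

  open import Data.List.Membership.DecPropositional (Fin._≟_ {N}) using (_∈?_)

  Repeats : List (Fin N) → (Fin N → ℕ) → ℕ → List (Fin N) → List (Fin N) → Set
  Repeats S f k A B =
    length A ≡ suc k × length B ≡ suc k × Path (A ++ B) × All (_∈ S) (A ++ B) × map f A ≡ map f B

  repeats? : ∀ S f k A B → Dec (Repeats S f k A B)
  repeats? S f k A B =
    (length A ≟ suc k) ×-dec (length B ≟ suc k) ×-dec path? (A ++ B)
      ×-dec all? (_∈? S) (A ++ B) ×-dec ≡-dec _≟_ (map f A) (map f B)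

  Clean : List (Fin N) → (Fin N → ℕ) → Set
  Clean S f = ∀ k A B → ¬ Repeats S f k A B

  repeats-reverse : ∀ {S f k} A B → Repeats S f k A B → Repeats S f k (reverse B) (reverse A)
  repeats-reverse {S} {f} A B (lA , lB , p , s , eq) =
    trans (length-reverse B) lB , trans (length-reverse A) lA ,
    subst Path (reverse-++ A B) (path-reverse p) ,
    subst (All (_∈ S)) (reverse-++ A B) (Perm.All-resp-↭ (↭-sym (Perm.↭-reverse (A ++ B))) s) ,
    trans (reverse-map f B) (trans (cong reverse (sym eq)) (sym (reverse-map f A)))

  repeats-resp : ∀ {S T f g k} A B → (∀ {i} → i ∈ A ++ B → i ∈ T) →
    (∀ {i} → i ∈ A ++ B → f i ≡ g i) → Repeats S f k A B → Repeats T g k A B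
  repeats-resp A B sub ext (lA , lB , p , s , eq) = lA , lB , p , All.tabulate sub ,
    trans (sym (map-cong-local (All.tabulate λ i∈ → ext (∈-++⁺ˡ i∈))))
      (trans eq (map-cong-local (All.tabulate λ i∈ → ext (∈-++⁺ʳ A i∈))))

  clean-resp : ∀ {S T f g} → T ⊆ S → (∀ {i} → i ∈ T → f i ≡ g i) → Clean S f → Clean T g
  clean-resp T⊆S ext c k A B r@(_ , _ , _ , s , _) =
    c k A B (repeats-resp A B (λ i∈ → T⊆S (All.lookup s i∈)) (λ i∈ → sym (ext (All.lookup s i∈))) r)

  -- Replaces the unbounded search over `k`, `A` and `B` in `Clean` by a finite one, which makes
  -- `Clean` decidable.
  Listed : List (Fin N) → (Fin N → ℕ) → Fin N → Set
  Listed S f x = Any (λ k → Any (λ P → Repeats S f k (proj₁ P) (proj₂ P)) (pairs x k)) (downFrom N)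

  listed? : ∀ S f x → Dec (Listed S f x)
  listed? S f x = any? (λ k → any? (λ P → repeats? S f k (proj₁ P) (proj₂ P)) (pairs x k)) (downFrom N)

  -- The `k + 1` entries of `A` are distinct members of `Fin N`, so `downFrom N` exhausts the
  -- possible `k`.
  repeats-short : ∀ {S f k A B} → Repeats S f k A B → k < N
  repeats-short {k = k} {A} {B} (lA , _ , p , _) =
    ≤-trans (≤-reflexive (sym lA)) (length-Fin-≤ (Unique-++⁻ˡ A (path-unique p)))

  repeats⇒listed : ∀ {S f k x} A B → Repeats S f k A B → x ∈ A ++ B → Listed S f x
  repeats⇒listed {k = k} A B r@(lA , lB , p , _) x∈ with pairs-cover k A B lA lB p x∈
  ... | inj₁ AB∈ = lose (∈-downFrom⁺ (repeats-short r)) (lose AB∈ r)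
  ... | inj₂ BA∈ = lose (∈-downFrom⁺ (repeats-short r)) (lose BA∈ (repeats-reverse A B r))

  clean? : ∀ S f → Dec (Clean S f)
  clean? S f with any? (listed? S f) S
  ... | yes a = no λ c → case find a of λ { (x , _ , a₁) → case find a₁ of λ { (k , _ , a₂) →
          case find a₂ of λ { ((A , B) , _ , r) → c k A B r } } }
  ... | no ¬a = yes λ
    { k (y ∷ A) B r@(_ , _ , _ , y∈S ∷ _ , _) → ¬a (lose y∈S (repeats⇒listed (y ∷ A) B r (here refl))) }

  -- Outside `S` only the dummy colour 0 is allowed, so each partial colouring of `S` is represented
  -- by exactly one vector.
  palette : List (Fin N) → Fin N → List ℕ
  palette S i = if does (i ∈? S) then L i else [ 0 ]

  FromPalette : List (Fin N) → Vec ℕ N → Set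
  FromPalette S v = (∀ {i} → i ∈ S → lookup v i ∈ L i) × (∀ {i} → i ∉ S → lookup v i ≡ 0)

  palette⁺ : ∀ {S v} → FromPalette S v → v ∈ vectors (palette S)
  palette⁺ {S} {v} (h₁ , h₂) = ∈-vectors⁺ v h
    where
    h : ∀ i → lookup v i ∈ palette S i
    h i with i ∈? S
    ... | yes i∈ = h₁ i∈
    ... | no i∉  = here (h₂ i∉)

  palette⁻ : ∀ {S v} → v ∈ vectors (palette S) → FromPalette S v
  palette⁻ {S} {v} v∈ = h₁ , h₂
    where
    h₁ : ∀ {i} → i ∈ S → lookup v i ∈ L i
    h₁ {i} i∈ with i ∈? S | ∈-vectors⁻ v v∈ i
    ... | yes _ | p = p
    ... | no i∉ | _ = contradiction i∈ i∉
    h₂ : ∀ {i} → i ∉ S → lookup v i ≡ 0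
    h₂ {i} i∉ with i ∈? S | ∈-vectors⁻ v v∈ i
    ... | yes i∈ | _ = contradiction i∈ i∉
    ... | no _ | here p = p

  palette-unique : ∀ {S} → All V S → Unique (vectors (palette S))
  palette-unique {S} S⊆V = vectors-unique u
    where
    u : ∀ i → Unique (palette S i)
    u i with i ∈? S
    ... | yes i∈ = L-unique (All.lookup S⊆V i∈)
    ... | no _   = [] ∷ []

  -- The coloured set and the set kept free of repetitions are separate: `candidates (x ∷ S) S`
  -- consists of all extensions to `x` of good colourings of `S`, the spoiled ones included.
  candidates : List (Fin N) → List (Fin N) → List (Vec ℕ N)
  candidates S T = filter (λ v → clean? T (lookup v)) (vectors (palette S))

  colourings : List (Fin N) → List (Vec ℕ N)
  colourings S = candidates S S

  count : List (Fin N) → ℕ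
  count S = length (colourings S)

  candidates⁺ : ∀ S T {v} → FromPalette S v → Clean T (lookup v) → v ∈ candidates S T
  candidates⁺ S T p c = ∈-filter⁺ (λ v → clean? T (lookup v)) (palette⁺ p) c

  candidates⁻ : ∀ S T {v} → v ∈ candidates S T → FromPalette S v × Clean T (lookup v)
  candidates⁻ S T v∈ with ∈-filter⁻ (λ v → clean? T (lookup v)) v∈
  ... | p , c = palette⁻ p , c

  candidates-unique : ∀ S T → All V S → Unique (candidates S T)
  candidates-unique S T S⊆V = Unique.filter⁺ (λ v → clean? T (lookup v)) (palette-unique S⊆V)

  -- `palette` and `Clean` depend only on membership, so the order in which a set is listed does not
  -- affect its count.
  count-≤ : ∀ {S T} → All V S → S ⊆ T → T ⊆ S → count S ≤ count T
  count-≤ {S} {T} S⊆V S⊆T T⊆S = Unique-⊆-length (candidates-unique S S S⊆V) λ v∈ →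
    let ((h₁ , h₂) , c) = candidates⁻ S S v∈ in
    candidates⁺ T T ((λ i∈ → h₁ (T⊆S i∈)) , (λ i∉ → h₂ (i∉ ∘ S⊆T))) (clean-resp T⊆S (λ _ → refl) c)

  GrowsBelow : ℕ → Set
  GrowsBelow n = ∀ {S x} → length S < n → Unique (x ∷ S) → All V (x ∷ S) → β * count S ≤ count (x ∷ S)

  -- The members of `J` are added to `T` one at a time. Read backwards, removing `J` divides the
  -- count by at least `β ^ length J`.
  grows-iterated : ∀ {n} J T → GrowsBelow n → length (J ++ T) ≤ n → Unique (J ++ T) → All V (J ++ T) →
    β ^ length J * count T ≤ count (J ++ T)
  grows-iterated [] T _ _ _ _ = ≤-reflexive (*-identityˡ _)
  grows-iterated (j ∷ J) T ih len u@(_ ∷ u′) v@(_ ∷ v′) = begin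
    β * β ^ length J * count T      ≡⟨ *-assoc β _ _ ⟩
    β * (β ^ length J * count T)    ≤⟨ *-monoʳ-≤ β (grows-iterated J T ih (≤-trans (n≤1+n _) len) u′ v′) ⟩
    β * count (J ++ T)              ≤⟨ ih len u v ⟩
    count (j ∷ J ++ T)              ∎
    where open ≤-Reasoning

  -- The inductive step: adding `x` to `S`.

  module Half {n S x} (ih : GrowsBelow n) (S≤n : length S ≤ n) (xS-unique : Unique (x ∷ S)) (xS⊆V : All V (x ∷ S)) where

    x∉S : x ∉ S
    x∉S = Unique.Unique[x∷xs]⇒x∉xs xS-unique

    S-unique : Unique S
    S-unique = Unique-++⁻ʳ [ x ] xS-unique

    S⊆V : All V S
    S⊆V = All.tail xS⊆V

    restrict : List (Fin N) → Vec ℕ N → Vec ℕ N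
    restrict T v = tabulate (λ i → if does (i ∈? T) then lookup v i else 0)

    restrict-∈ : ∀ {T i} v → i ∈ T → lookup (restrict T v) i ≡ lookup v i
    restrict-∈ {T} {i} v i∈ = trans (lookup∘tabulate _ i) h
      where
      h : (if does (i ∈? T) then lookup v i else 0) ≡ lookup v i
      h with i ∈? T
      ... | yes _ = refl
      ... | no i∉ = contradiction i∈ i∉

    restrict-∉ : ∀ {T i} v → i ∉ T → lookup (restrict T v) i ≡ 0
    restrict-∉ {T} {i} v i∉ = trans (lookup∘tabulate _ i) h
      where
      h : (if does (i ∈? T) then lookup v i else 0) ≡ 0
      h with i ∈? T
      ... | yes i∈ = contradiction i∈ i∉
      ... | no _ = refl

    -- A colouring whose two halves agree is determined outside the half H containing x, and removing
    -- H ∖ x from S costs a factor β for each of its k elements.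
    repeating-≤ : ∀ {k} H H′ vs → length H ≡ suc k → Unique (H ++ H′) → All (_∈ x ∷ S) (H ++ H′) → x ∈ H →
      Unique vs → (∀ {v} → v ∈ vs → v ∈ candidates (x ∷ S) S × map (lookup v) H ≡ map (lookup v) H′) →
      length vs * β ^ k ≤ count S
    repeating-≤ {k} H H′ vs len u sub x∈ vs-unique vs-spec with ∈-∃++ x∈
    ... | h₁ , h₂ , refl = begin
        length vs * β ^ k              ≤⟨ *-monoˡ-≤ (β ^ k) vs≤ ⟩
        count T * β ^ k                ≡⟨ *-comm (count T) _ ⟩
        β ^ k * count T                ≡⟨ cong (λ m → β ^ m * count T) (sym J-length) ⟩
        β ^ length J * count T         ≤⟨ grows-iterated J T ih (≤-trans (Unique-⊆-length JT-unique JT⊆S) S≤n) JT-unique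
                                            (All.tabulate λ i∈ → All.lookup S⊆V (JT⊆S i∈)) ⟩
        count (J ++ T)                 ≤⟨ count-≤ (All.tabulate λ i∈ → All.lookup S⊆V (JT⊆S i∈)) JT⊆S S⊆JT ⟩
        count S                        ∎
      where
      open ≤-Reasoning
      J = h₁ ++ h₂
      T = filter (λ i → ¬? (i ∈? H)) S
      H↭ : H ↭ x ∷ J
      H↭ = Perm.shift x h₁ h₂
      J-length : length J ≡ k
      J-length = suc-injective (trans (sym (Perm.↭-length H↭)) len)
      xJ-unique : Unique (x ∷ J)
      xJ-unique = Unique-resp-↭ H↭ (Unique-++⁻ˡ H u)
      T⁻ : ∀ {i} → i ∈ T → i ∈ S × i ∉ H
      T⁻ = ∈-filter⁻ (λ i → ¬? (i ∈? H))
      T⁺ : ∀ {i} → i ∈ S → i ∉ H → i ∈ T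
      T⁺ = ∈-filter⁺ (λ i → ¬? (i ∈? H))
      J⊆H : J ⊆ H
      J⊆H i∈ = Perm.∈-resp-↭ (↭-sym H↭) (there i∈)
      JT-unique : Unique (J ++ T)
      JT-unique = Unique.++⁺ (Unique-++⁻ʳ [ x ] xJ-unique) (Unique.filter⁺ (λ i → ¬? (i ∈? H)) S-unique)
        λ (i∈J , i∈T) → proj₂ (T⁻ i∈T) (J⊆H i∈J)
      JT⊆S : J ++ T ⊆ S
      JT⊆S i∈ with ∈-++⁻ J i∈
      ... | inj₂ i∈T = proj₁ (T⁻ i∈T)
      ... | inj₁ i∈J with All.lookup sub (∈-++⁺ˡ (J⊆H i∈J))
      ...   | here refl = contradiction i∈J (Unique.Unique[x∷xs]⇒x∉xs xJ-unique)
      ...   | there i∈S = i∈S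
      S⊆JT : S ⊆ J ++ T
      S⊆JT {i} i∈ with i ∈? H
      ... | no i∉H = ∈-++⁺ʳ J (T⁺ i∈ i∉H)
      ... | yes i∈H with Perm.∈-resp-↭ H↭ i∈H
      ...   | here refl = contradiction i∈ x∉S
      ...   | there i∈J = ∈-++⁺ˡ i∈J
      H′⊆T : H′ ⊆ T
      H′⊆T i∈ with All.lookup sub (∈-++⁺ʳ H i∈)
      ... | here refl = contradiction i∈ (Unique-++-disjoint H u x∈)
      ... | there i∈S = T⁺ i∈S λ i∈H → Unique-++-disjoint H u i∈H i∈
      restrict∈ : ∀ {v} → v ∈ vs → restrict T v ∈ colourings T
      restrict∈ {v} v∈ with candidates⁻ (x ∷ S) S (proj₁ (vs-spec v∈))
      ... | (h , _) , c = candidates⁺ T T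
        ((λ {i} i∈ → subst (_∈ L i) (sym (restrict-∈ v i∈)) (h (there (proj₁ (T⁻ i∈))))) , restrict-∉ v)
        (clean-resp (proj₁ ∘ T⁻) (λ i∈ → sym (restrict-∈ v i∈)) c)
      restrict-injective : ∀ {v v′} → v ∈ vs → v′ ∈ vs → restrict T v ≡ restrict T v′ → v ≡ v′
      restrict-injective {v} {v′} v∈ v′∈ eq = lookup-ext v v′ agree
        where
        agreeT : ∀ {i} → i ∈ T → lookup v i ≡ lookup v′ i
        agreeT {i} i∈ = trans (sym (restrict-∈ v i∈)) (trans (cong (λ u → lookup u i) eq) (restrict-∈ v′ i∈))
        -- The colours on `H` are copied from `H′`, which is disjoint from `H` and hence lies in
        -- `T`.
        agreeH : map (lookup v) H ≡ map (lookup v′) H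
        agreeH = trans (proj₂ (vs-spec v∈))
          (trans (map-cong-local (All.tabulate λ i∈ → agreeT (H′⊆T i∈))) (sym (proj₂ (vs-spec v′∈))))
        outside : ∀ {v i} → v ∈ vs → i ∉ x ∷ S → lookup v i ≡ 0
        outside v∈ = proj₂ (proj₁ (candidates⁻ (x ∷ S) S (proj₁ (vs-spec v∈))))
        agree : ∀ i → lookup v i ≡ lookup v′ i
        agree i with i ∈? H
        ... | yes i∈H = map-≡-∈ agreeH i∈H
        ... | no i∉H with i ∈? S
        ...   | yes i∈S = agreeT (T⁺ i∈S i∉H)
        ...   | no i∉S = trans (outside v∈ i∉) (sym (outside v′∈ i∉))
          where
          i∉ : i ∉ x ∷ S
          i∉ (here refl) = i∉H x∈
          i∉ (there i∈) = i∉S i∈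
      vs≤ : length vs ≤ count T
      vs≤ = injection-length (colourings T) (restrict T) vs-unique restrict∈ restrict-injective

    -- Membership of `x` is recorded because `pairs x k` may also contain pairs that do not form a
    -- path through `x`.
    Repeating : ℕ → List (Fin N) × List (Fin N) → Vec ℕ N → Set
    Repeating k (A , B) v = Repeats (x ∷ S) (lookup v) k A B × x ∈ A ++ B

    repeating? : ∀ k AB v → Dec (Repeating k AB v)
    repeating? k (A , B) v = repeats? (x ∷ S) (lookup v) k A B ×-dec (x ∈? A ++ B)

    spoiled : ℕ → List (Fin N) × List (Fin N) → List (Vec ℕ N)
    spoiled k AB = filter (repeating? k AB) (candidates (x ∷ S) S)

    spoiled-≤ : ∀ k AB → length (spoiled k AB) * β ^ k ≤ count S
    spoiled-≤ k (A , B) = go (spoiled k (A , B)) (Unique.filter⁺ (repeating? k (A , B)) (candidates-unique (x ∷ S) S xS⊆V))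
        (∈-filter⁻ (repeating? k (A , B)))
      where
      go : ∀ vs → Unique vs → (∀ {v} → v ∈ vs → v ∈ candidates (x ∷ S) S × Repeating k (A , B) v) →
        length vs * β ^ k ≤ count S
      go [] _ _ = z≤n
      -- Any spoiled colouring certifies that `A ++ B` is a path in `x ∷ S` through `x`. The half
      -- containing `x` then plays the role of `H`.
      go vs@(_ ∷ _) vs-unique spec with proj₂ (spec (here refl))
      ... | (lA , lB , p , s , _) , x∈ with ∈-++⁻ A x∈
      ...   | inj₁ x∈A = repeating-≤ A B vs lA (path-unique p) s x∈A vs-unique
                λ v∈ → let (c , (_ , _ , _ , _ , eq) , _) = spec v∈ in c , eq
      ...   | inj₂ x∈B = repeating-≤ B A vs lB (Unique-resp-↭ (Perm.++-comm A B) (path-unique p))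
                (Perm.All-resp-↭ (Perm.++-comm A B) s) x∈B vs-unique
                λ v∈ → let (c , (_ , _ , _ , _ , eq) , _) = spec v∈ in c , sym eq

    spoiledAt : ℕ → List (Vec ℕ N)
    spoiledAt k = concatMap (spoiled k) (pairs x k)

    spoiledAt-≤ : ∀ k → length (spoiledAt k) * β ^ k ≤ w k * count S
    spoiledAt-≤ k = begin
      length (spoiledAt k) * β ^ k                          ≡⟨ cong (_* β ^ k) (length-concatMap (spoiled k) (pairs x k)) ⟩
      sum (map (length ∘ spoiled k) (pairs x k)) * β ^ k
        ≤⟨ sum-scaled-≤ (length ∘ spoiled k) (pairs x k) (λ {AB} _ → spoiled-≤ k AB) ⟩
      length (pairs x k) * count S                          ≤⟨ *-monoˡ-≤ (count S) (pairs-size (All.head xS⊆V) k) ⟩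
      w k * count S                                         ∎
      where open ≤-Reasoning

    -- A repetition avoiding `x` would lie in `S`, where a candidate is already clean; one through
    -- `x` is listed in one of its directions. So a candidate is either good or spoiled.
    candidate-cases : candidates (x ∷ S) S ⊆ colourings (x ∷ S) ++ concatMap spoiledAt (downFrom N)
    candidate-cases {v} v∈ with candidates⁻ (x ∷ S) S v∈
      | any? (λ k → any? (λ AB → repeating? k AB v) (pairs x k)) (downFrom N)
    ... | fp , c | yes a = ∈-++⁺ʳ (colourings (x ∷ S))
            (case find a of λ { (k , k∈ , a₁) → case find a₁ of λ { (AB , AB∈ , r) →
            ∈-concatMap⁺ spoiledAt (lose k∈ (∈-concatMap⁺ (spoiled k) (lose AB∈ (∈-filter⁺ (repeating? k AB) v∈ r)))) } })
    ... | fp , c | no ¬a = ∈-++⁺ˡ (candidates⁺ (x ∷ S) (x ∷ S) fp c′)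
      where
      c′ : Clean (x ∷ S) (lookup v)
      c′ k A B r@(lA , lB , p , s , _) with x ∈? A ++ B
      ... | no x∉ = c k A B (repeats-resp A B inS (λ _ → refl) r)
        where
        inS : ∀ {i} → i ∈ A ++ B → i ∈ S
        inS i∈ with All.lookup s i∈
        ... | here refl = contradiction i∈ x∉
        ... | there i∈S = i∈S
      ... | yes x∈ with pairs-cover k A B lA lB p x∈
      ...   | inj₁ AB∈ = ¬a (lose (∈-downFrom⁺ (repeats-short r)) (lose AB∈ (r , x∈)))
      ...   | inj₂ BA∈ = ¬a (lose (∈-downFrom⁺ (repeats-short r)) (lose BA∈ (repeats-reverse A B r ,
                subst (x ∈_) (reverse-++ A B) (Perm.∈-resp-↭ (↭-sym (Perm.↭-reverse (A ++ B))) x∈))))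

    -- Recolouring `x` alone creates no repetition inside `S`, so every good colouring of `S`
    -- combines with every colour of `L x`.
    extensions-≤ : length (L x) * count S ≤ length (candidates (x ∷ S) S)
    extensions-≤ = subst (_≤ length (candidates (x ∷ S) S)) (length-cartesianProductWith _,_ (L x) (colourings S))
      (injection-length (candidates (x ∷ S) S) extend
        (Unique.cartesianProduct⁺ (L-unique (All.head xS⊆V)) (candidates-unique S S S⊆V)) extend∈ extend-injective)
      where
      extend : ℕ × Vec ℕ N → Vec ℕ N
      extend (a , v) = v [ x ]≔ a
      extend-other : ∀ {i} a v → i ≢ x → lookup (extend (a , v)) i ≡ lookup v i
      extend-other {i} a v i≢x = lookup∘updateAt′ i x i≢x v
      ∈S⇒≢x : ∀ {i} → i ∈ S → i ≢ x
      ∈S⇒≢x i∈ refl = x∉S i∈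
      extend∈ : ∀ {av} → av ∈ cartesianProduct (L x) (colourings S) → extend av ∈ candidates (x ∷ S) S
      extend∈ {a , v} av∈ with ∈-cartesianProduct⁻ (L x) (colourings S) av∈
      ... | a∈ , v∈ with candidates⁻ S S v∈
      ...   | (h₁ , h₂) , c = candidates⁺ (x ∷ S) S
        ( (λ { (here refl) → subst (_∈ L x) (sym (lookup∘updateAt x v)) a∈
             ; {i} (there i∈) → subst (_∈ L i) (sym (extend-other a v (∈S⇒≢x i∈))) (h₁ i∈) })
        , (λ i∉ → trans (extend-other a v (i∉ ∘ here)) (h₂ (i∉ ∘ there))))
        (clean-resp id (λ i∈ → sym (extend-other a v (∈S⇒≢x i∈))) c)
      extend-injective : ∀ {p q} → p ∈ cartesianProduct (L x) (colourings S) → q ∈ cartesianProduct (L x) (colourings S) →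
        extend p ≡ extend q → p ≡ q
      extend-injective {a , v} {b , v′} p∈ q∈ eq = cong₂ _,_
          (trans (sym (lookup∘updateAt x v)) (trans (cong (λ u → lookup u x) eq) (lookup∘updateAt x v′)))
          (lookup-ext v v′ agree)
        where
        -- Overwriting the entry at `x` loses nothing: a colouring of `S` holds the dummy 0 there.
        zero-at-x : ∀ {a u} → (a , u) ∈ cartesianProduct (L x) (colourings S) → lookup u x ≡ 0
        zero-at-x m = proj₂ (proj₁ (candidates⁻ S S (proj₂ (∈-cartesianProduct⁻ (L x) (colourings S) m)))) x∉S
        agree : ∀ i → lookup v i ≡ lookup v′ i
        agree i with i Fin.≟ x
        ... | yes refl = trans (zero-at-x p∈) (sym (zero-at-x q∈))
        ... | no i≢x = trans (sym (extend-other a v i≢x)) (trans (cong (λ u → lookup u i) eq) (extend-other b v′ i≢x))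

    -- The number of spoiled extensions is added to both sides and cancelled at the end, which
    -- avoids subtraction.
    grow : β * count S ≤ count (x ∷ S)
    grow = +-cancelʳ-≤ (sum (map (length ∘ spoiledAt) (downFrom N))) _ _ (begin
      β * count S + sum (map (length ∘ spoiledAt) (downFrom N))
        ≤⟨ budget (count S) (length ∘ spoiledAt) spoiledAt-≤ ⟩
      l * count S
        ≤⟨ *-monoˡ-≤ (count S) (L-size (All.head xS⊆V)) ⟩
      length (L x) * count S
        ≤⟨ extensions-≤ ⟩
      length (candidates (x ∷ S) S)
        ≤⟨ Unique-⊆-length (candidates-unique (x ∷ S) S xS⊆V) candidate-cases ⟩
      length (colourings (x ∷ S) ++ concatMap spoiledAt (downFrom N))
        ≡⟨ length-++ (colourings (x ∷ S)) ⟩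
      count (x ∷ S) + length (concatMap spoiledAt (downFrom N))
        ≡⟨ cong (count (x ∷ S) +_) (length-concatMap spoiledAt (downFrom N)) ⟩
      count (x ∷ S) + sum (map (length ∘ spoiledAt) (downFrom N)) ∎)
      where open ≤-Reasoning

  grows-below : ∀ n → GrowsBelow n
  grows-below (suc n) (s≤s S≤n) u v = Half.grow (grows-below n) S≤n u v

  -- The all-zero vector is the good colouring of the empty set, and each added element multiplies
  -- the count by at least `β`, which is at least 1.
  count-positive : ∀ S → Unique S → All V S → 1 ≤ count S
  count-positive [] _ _ = ∈-length (candidates⁺ [] [] {tabulate λ _ → 0}
    ((λ ()) , λ {i} _ → lookup∘tabulate _ i) λ { k (_ ∷ _) B (_ , _ , _ , () ∷ _ , _) })
  count-positive (x ∷ S) u@(_ ∷ u′) v@(_ ∷ v′) =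
    ≤-trans (*-mono-≤ 1≤β (count-positive S u′ v′)) (grows-below (suc (length S)) ≤-refl u v)

  clean-colouring : ∀ S → Unique S → All V S → ∃[ f ] (∀ {i} → i ∈ S → f i ∈ L i) × Clean S f
  clean-colouring S u v with colourings S in eq | count-positive S u v
  ... | c ∷ _ | _ with candidates⁻ S S (subst (c ∈_) (sym eq) (here refl))
  ...   | (h , _) , clean = lookup c , h , clean

-- Arithmetic: the budget inequality and parity of positions.

sum-≤-first : ∀ (s : ℕ → ℕ) → (∀ k → s (suc k) ≡ 0) → ∀ K → sum (map s (downFrom K)) ≤ s 0
sum-≤-first s h zero = z≤n
sum-≤-first s h (suc zero) = ≤-reflexive (+-identityʳ (s 0))
sum-≤-first s h (suc (suc K)) =
  ≤-trans (≤-reflexive (cong (_+ sum (map s (downFrom (suc K)))) (h K))) (sum-≤-first s h (suc K))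

-- This clears denominators in the closed form: the sum of (k + 1) / 2^k over k < K equals 4 - (2K +
-- 4) / 2^K. Keeping the remainder makes the induction work.
geometric : ∀ B (s : ℕ → ℕ) → (∀ k → s k * 2 ^ k ≤ suc k * B) →
  ∀ K → sum (map s (downFrom K)) * 2 ^ K + (2 * K + 4) * B ≤ 4 * B * 2 ^ K
geometric B s h zero = ≤-reflexive (sym (*-identityʳ (4 * B)))
geometric B s h (suc K) = begin
  (s K + Σs) * (2 * 2 ^ K) + (2 * suc K + 4) * B
    ≡⟨ solve 5 (λ t S p k b → (t :+ S) :* (con 2 :* p) :+ (con 2 :* (con 1 :+ k) :+ con 4) :* b
        := con 2 :* (t :* p) :+ (con 2 :* (S :* p) :+ (con 2 :* k :+ con 6) :* b)) refl (s K) Σs (2 ^ K) K B ⟩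
  2 * (s K * 2 ^ K) + (2 * (Σs * 2 ^ K) + (2 * K + 6) * B)
    ≤⟨ +-monoˡ-≤ _ (*-monoʳ-≤ 2 (h K)) ⟩
  2 * (suc K * B) + (2 * (Σs * 2 ^ K) + (2 * K + 6) * B)
    ≡⟨ solve 4 (λ S p k b → con 2 :* ((con 1 :+ k) :* b) :+ (con 2 :* (S :* p) :+ (con 2 :* k :+ con 6) :* b)
        := con 2 :* (S :* p :+ (con 2 :* k :+ con 4) :* b)) refl Σs (2 ^ K) K B ⟩
  2 * (Σs * 2 ^ K + (2 * K + 4) * B)
    ≤⟨ *-monoʳ-≤ 2 (geometric B s h K) ⟩
  2 * (4 * B * 2 ^ K)
    ≡⟨ solve 2 (λ p b → con 2 :* (con 4 :* b :* p) := con 4 :* b :* (con 2 :* p)) refl (2 ^ K) B ⟩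
  4 * B * (2 * 2 ^ K) ∎
  where
  open ≤-Reasoning
  open +-*-Solver
  Σs = sum (map s (downFrom K))

geometric-≤ : ∀ B (s : ℕ → ℕ) → (∀ k → s k * 2 ^ k ≤ suc k * B) → ∀ K → sum (map s (downFrom K)) ≤ 4 * B
geometric-≤ B s h K = *-cancelʳ-≤ _ _ (2 ^ K) {{m^n≢0 2 K}} (≤-trans (m≤m+n _ _) (geometric B s h K))

^-distribʳ-* : ∀ k m n → (m * n) ^ k ≡ m ^ k * n ^ k
^-distribʳ-* zero m n = refl
^-distribʳ-* (suc k) m n = begin
  m * n * (m * n) ^ k        ≡⟨ cong (m * n *_) (^-distribʳ-* k m n) ⟩
  m * n * (m ^ k * n ^ k)    ≡⟨ *-assoc m n _ ⟩
  m * (n * (m ^ k * n ^ k))  ≡⟨ cong (m *_) (*-comm n _) ⟩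
  m * (m ^ k * n ^ k * n)    ≡⟨ cong (m *_) (*-assoc (m ^ k) _ n) ⟩
  m * (m ^ k * (n ^ k * n))  ≡⟨ cong (λ x → m * (m ^ k * x)) (*-comm (n ^ k) n) ⟩
  m * (m ^ k * (n * n ^ k))  ≡⟨ sym (*-assoc m (m ^ k) _) ⟩
  m * m ^ k * (n * n ^ k)    ∎
  where open ≡-Reasoning

-- Here `d` is Δ - 1. For Δ = 1 the factor `d ^ k` leaves only `k = 0`, with weight 2, and 2 + 2 ≤
-- 6. Otherwise `suc d ⊔ 2` is Δ; weakening `d ^ k` to Δ^k and cancelling it against (2Δ)^k leaves a
-- series bounded by 4Δ, and 2Δ + 4Δ = 6Δ.
budget : ∀ d K C (s : ℕ → ℕ) → (∀ k → s k * (2 * suc d) ^ k ≤ suc k * ((suc d ⊔ 2) * d ^ k) * C) →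
  2 * suc d * C + sum (map s (downFrom K)) ≤ 6 * suc d * C
budget zero K C s h = begin
  2 * C + sum (map s (downFrom K))    ≤⟨ +-monoʳ-≤ (2 * C) (sum-≤-first s vanish K) ⟩
  2 * C + s 0                         ≤⟨ +-monoʳ-≤ (2 * C) (subst (_≤ 2 * C) (*-identityʳ (s 0)) (h 0)) ⟩
  2 * C + 2 * C                       ≡⟨ sym (*-distribʳ-+ C 2 2) ⟩
  4 * C                               ≤⟨ *-monoˡ-≤ C {4} {6} (s≤s (s≤s (s≤s (s≤s z≤n)))) ⟩
  6 * C                               ∎
  where
  open ≤-Reasoning
  vanish : ∀ k → s (suc k) ≡ 0
  vanish k = m*n≡0⇒m≡0 (s (suc k)) (2 ^ suc k) {{m^n≢0 2 (suc k)}}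
    (n≤0⇒n≡0 (≤-trans (h (suc k)) (≤-reflexive (cong (_* C) (*-zeroʳ (suc (suc k)))))))
budget d@(suc _) K C s h = begin
  2 * Δ * C + sum (map s (downFrom K))    ≤⟨ +-monoʳ-≤ (2 * Δ * C) (geometric-≤ (Δ * C) s h′ K) ⟩
  2 * Δ * C + 4 * (Δ * C)
    ≡⟨ solve 2 (λ x c → con 2 :* x :* c :+ con 4 :* (x :* c) := con 6 :* x :* c) refl Δ C ⟩
  6 * Δ * C                               ∎
  where
  open ≤-Reasoning
  open +-*-Solver
  Δ = suc d
  h′ : ∀ k → s k * 2 ^ k ≤ suc k * (Δ * C)
  h′ k = *-cancelʳ-≤ _ _ (Δ ^ k) {{m^n≢0 Δ k}} (begin
    s k * 2 ^ k * Δ ^ k              ≡⟨ *-assoc (s k) _ _ ⟩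
    s k * (2 ^ k * Δ ^ k)            ≡⟨ cong (s k *_) (sym (^-distribʳ-* k 2 Δ)) ⟩
    s k * (2 * Δ) ^ k                ≤⟨ h k ⟩
    suc k * ((Δ ⊔ 2) * d ^ k) * C
      ≤⟨ *-monoˡ-≤ C (*-monoʳ-≤ (suc k) (*-mono-≤ {Δ ⊔ 2} {Δ} {d ^ k} {Δ ^ k}
        (≤-reflexive (m≥n⇒m⊔n≡m {Δ} {2} (s≤s (s≤s z≤n)))) (^-monoˡ-≤ k (n≤1+n d)))) ⟩
    suc k * (Δ * Δ ^ k) * C
      ≡⟨ solve 4 (λ x k p c → k :* (x :* p) :* c := k :* (x :* c) :* p) refl Δ (suc k) (Δ ^ k) C ⟩
    suc k * (Δ * C) * Δ ^ k          ∎)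

-- Unlike `2 * n`, this computes to two successors, so walks of length `double (suc a)` unfold two
-- steps at once.
double : ℕ → ℕ
double zero = 0
double (suc n) = suc (suc (double n))

n+n≡double : ∀ n → n + n ≡ double n
n+n≡double zero = refl
n+n≡double (suc n) = cong suc (trans (+-suc n n) (cong suc (n+n≡double n)))

-- Position of an element in a sequence of even length: exactly one of the two sides is even.
split-double : ∀ p q k → p + suc q ≡ double (suc k) →
  ∃[ a ] ∃[ b ] a + b ≡ k × (p ≡ double a × q ≡ suc (double b) ⊎ p ≡ suc (double a) × q ≡ double b)
split-double zero q k eq = 0 , k , refl , inj₁ (refl , suc-injective eq)
split-double (suc zero) q k eq = 0 , k , refl , inj₂ (refl , suc-injective (suc-injective eq))
split-double (suc (suc p)) q zero eq = contradiction (trans (sym (+-suc p q)) (suc-injective (suc-injective eq))) λ ()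
split-double (suc (suc p)) q (suc k) eq with split-double p q k (suc-injective (suc-injective eq))
... | a , b , refl , inj₁ (refl , refl) = suc a , b , refl , inj₁ (refl , refl)
... | a , b , refl , inj₂ (refl , refl) = suc a , b , refl , inj₂ (refl , refl)

-- Linked lists and splitting of lists.

module _ {A : Set} {R : A → A → Set} where

  Linked-++⁻ˡ : ∀ xs {ys} → Linked R (xs ++ ys) → Linked R xs
  Linked-++⁻ˡ [] _ = []
  Linked-++⁻ˡ (x ∷ []) _ = [-]
  Linked-++⁻ˡ (x ∷ y ∷ xs) (r ∷ rs) = r ∷ Linked-++⁻ˡ (y ∷ xs) rs

  Linked-++⁻ʳ : ∀ xs {ys} → Linked R (xs ++ ys) → Linked R ys
  Linked-++⁻ʳ [] rs = rs
  Linked-++⁻ʳ (x ∷ xs) rs = Linked-++⁻ʳ xs (Linked.tail rs)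

  Linked-reverse : (∀ {x y} → R x y → R y x) → ∀ {xs} → Linked R xs → Linked R (reverse xs)
  Linked-reverse R-sym [] = []
  Linked-reverse R-sym {x ∷ xs} rs = go xs rs [-]
    where
    go : ∀ {x} xs {ys} → Linked R (x ∷ xs) → Linked R (x ∷ ys) → Linked R (xs ʳ++ (x ∷ ys))
    go [] _ rys = rys
    go (y ∷ xs) (r ∷ rs) rys = go xs rs (R-sym r ∷ rys)

length-concatMap-≤ : ∀ {A B : Set} (f : A → List B) {c} xs → (∀ {x} → x ∈ xs → length (f x) ≤ c) →
  length (concatMap f xs) ≤ length xs * c
length-concatMap-≤ f [] _ = z≤n
length-concatMap-≤ f {c} (x ∷ xs) h =
  subst (_≤ suc (length xs) * c) (sym (length-++ (f x))) (+-mono-≤ (h (here refl)) (length-concatMap-≤ f xs (h ∘ there)))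

-- Lifts a factorisation of a colour sequence to the path, in order to locate the two halves of a
-- square.
map-≡-++ : ∀ {A B : Set} (f : A → B) xs us {vs} → map f xs ≡ us ++ vs →
  ∃[ ys ] ∃[ zs ] xs ≡ ys ++ zs × map f ys ≡ us × map f zs ≡ vs
map-≡-++ f xs [] eq = [] , xs , refl , refl , eq
map-≡-++ f (x ∷ xs) (u ∷ us) eq with map-≡-++ f xs us (∷-injectiveʳ eq)
... | ys , zs , refl , e₁ , e₂ = x ∷ ys , zs , refl , cong₂ _∷_ (∷-injectiveˡ eq) e₁ , e₂

reverse-around : ∀ {A : Set} (l : List A) x r → reverse (l ++ x ∷ r) ≡ reverse r ++ x ∷ reverse l
reverse-around l x r = trans (reverse-++ l (x ∷ r))
  (trans (cong (_++ reverse l) (unfold-reverse x r)) (++-assoc (reverse r) [ x ] (reverse l)))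

take-length-++ : ∀ {A : Set} {k} (xs : List A) {ys} → length xs ≡ k → take k (xs ++ ys) ≡ xs
take-length-++ [] refl = refl
take-length-++ (x ∷ xs) refl = cong (x ∷_) (take-length-++ xs refl)

drop-length-++ : ∀ {A : Set} {k} (xs : List A) {ys} → length xs ≡ k → drop k (xs ++ ys) ≡ ys
drop-length-++ [] refl = refl
drop-length-++ (x ∷ xs) refl = drop-length-++ xs refl

-- Numbering the elements of a graph.

module _ {n : ℕ} where

  -- A bijection from all candidate elements, including `edg a b` for arbitrary `a` and `b`;
  -- `IsElem` selects the genuine ones afterwards.
  encode : Elem n → Fin (n + n * n)
  encode (vtx v)   = v ↑ˡ n * n
  encode (edg a b) = n ↑ʳ combine a b

  decode : Fin (n + n * n) → Elem n
  decode i = [ vtx , uncurry edg ∘ remQuot n ]′ (splitAt n i)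

  decode-encode : ∀ x → decode (encode x) ≡ x
  decode-encode (vtx v)   = cong [ vtx , _ ]′ (Fin.splitAt-↑ˡ n v (n * n))
  decode-encode (edg a b) = trans (cong [ vtx , _ ]′ (Fin.splitAt-↑ʳ n (n * n) (combine a b)))
    (cong (uncurry edg) (Fin.remQuot-combine a b))

  encode-decode : ∀ i → encode (decode i) ≡ i
  encode-decode i with splitAt n i | Fin.join-splitAt n (n * n) i
  ... | inj₁ v | eq = eq
  ... | inj₂ j | eq = trans (cong (n ↑ʳ_) (Fin.combine-remQuot {n} n j)) eq

  infix 4 _≟ᴱ_
  _≟ᴱ_ : (p q : Elem n) → Dec (p ≡ q)
  p ≟ᴱ q = map′ (λ eq → trans (sym (decode-encode p)) (trans (cong decode eq) (decode-encode q)))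
    (cong encode) (encode p Fin.≟ encode q)

  open import Data.List.Relation.Unary.Unique.DecPropositional _≟ᴱ_ using (unique?)

  incident? : ∀ p q → Dec (Incident {n} p q)
  incident? (vtx v)   (edg a b) = (v Fin.≟ a) ⊎-dec (v Fin.≟ b)
  incident? (edg a b) (vtx v)   = (v Fin.≟ a) ⊎-dec (v Fin.≟ b)
  incident? (vtx _)   (vtx _)   = no λ ()
  incident? (edg _ _) (edg _ _) = no λ ()

  Incident-sym : ∀ {p q} → Incident {n} p q → Incident q p
  Incident-sym {vtx _} {edg _ _} i = i
  Incident-sym {edg _ _} {vtx _} i = i

  -- Mixed paths and their enumeration.

  module _ (G : Graph n) where

    isElem? : ∀ x → Dec (IsElem G x)
    isElem? (vtx _)   = yes tt
    isElem? (edg a b) = (a Fin.<? b) ×-dec (adj G a b Bool.≟ true)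

    mixedPath? : ∀ P → Dec (MixedPath G P)
    mixedPath? P = all? isElem? P ×-dec linked? incident? P ×-dec unique? P

    MixedPath-++⁻ˡ : ∀ P {Q} → MixedPath G (P ++ Q) → MixedPath G P
    MixedPath-++⁻ˡ P (e , l , u) = All.++⁻ˡ P e , Linked-++⁻ˡ P l , Unique-++⁻ˡ P u

    MixedPath-++⁻ʳ : ∀ P {Q} → MixedPath G (P ++ Q) → MixedPath G Q
    MixedPath-++⁻ʳ P (e , l , u) = All.++⁻ʳ P e , Linked-++⁻ʳ P l , Unique-++⁻ʳ P u

    MixedPath-reverse : ∀ {P} → MixedPath G P → MixedPath G (reverse P)
    MixedPath-reverse {P} (e , l , u) =
      Perm.All-resp-↭ (↭-sym (Perm.↭-reverse P)) e , Linked-reverse Incident-sym l ,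
      Unique-resp-↭ (↭-sym (Perm.↭-reverse P)) u

    neighbours : Fin n → List (Fin n)
    neighbours v = filter (λ u → adj G v u Bool.≟ true) (allFin n)

    -- The smaller endpoint comes first, as `IsElem` demands of an edge.
    link : Fin n → Fin n → Elem n
    link v u with v Fin.<? u
    ... | yes _ = edg v u
    ... | no _  = edg u v

    incidents : Elem n → List (Elem n)
    incidents (vtx v)   = map (link v) (neighbours v)
    incidents (edg a b) = vtx a ∷ vtx b ∷ []

    incidents⁺ : ∀ {p z} → IsElem G p → Incident p z → p ∈ incidents z
    incidents⁺ {edg a b} {vtx _} (a<b , ab) (inj₁ refl) =
      subst (_∈ incidents (vtx a)) link≡
        (∈-map⁺ (link a) (∈-filter⁺ (λ u → adj G a u Bool.≟ true) (∈-allFin b) ab))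
      where
      link≡ : link a b ≡ edg a b
      link≡ with a Fin.<? b
      ... | yes _ = refl
      ... | no a≮b = contradiction a<b a≮b
    incidents⁺ {edg a b} {vtx _} (a<b , ab) (inj₂ refl) =
      subst (_∈ incidents (vtx b)) link≡
        (∈-map⁺ (link b) (∈-filter⁺ (λ u → adj G b u Bool.≟ true) (∈-allFin a) (trans (Graph.sym G b a) ab)))
      where
      link≡ : link b a ≡ edg a b
      link≡ with b Fin.<? a
      ... | yes b<a = contradiction b<a (<-asym a<b)
      ... | no _ = refl
    incidents⁺ {vtx _} {edg a b} _ (inj₁ refl) = here refl
    incidents⁺ {vtx _} {edg a b} _ (inj₂ refl) = there (here refl)

    incidents⁻ : ∀ {q} z → IsElem G z → q ∈ incidents z → IsElem G q × Incident z q
    incidents⁻ (edg a b) _ (here refl) = tt , inj₁ refl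
    incidents⁻ (edg a b) _ (there (here refl)) = tt , inj₂ refl
    incidents⁻ (vtx v) _ q∈ with ∈-map⁻ (link v) q∈
    ... | u , u∈ , refl with ∈-filter⁻ (λ u → adj G v u Bool.≟ true) {xs = allFin n} u∈
    ...   | _ , vu with v Fin.<? u
    ...     | yes v<u = (v<u , vu) , inj₁ refl
    ...     | no v≮u = (Fin.≤∧≢⇒< (≮⇒≥ v≮u) u≢v , trans (Graph.sym G u v) vu) , inj₂ refl
      where
      u≢v : u ≢ v
      u≢v refl = contradiction (trans (sym vu) (irrfl G v)) λ ()

    next : Elem n → Elem n → List (Elem n)
    next p z = filter (λ q → ¬? (q ≟ᴱ p)) (incidents z)

    -- Continuations by `m` elements of a sequence ending in `p`, `z`. Only stepping straight back
    -- is forbidden, so the mixed paths are overcounted, but the choices at each step depend on just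
    -- the last two elements.
    walks : Elem n → Elem n → ℕ → List (List (Elem n))
    walks p z zero = [ [] ]
    walks p z (suc m) = concatMap (λ q → map (q ∷_) (walks z q m)) (next p z)

    walks⁺ : ∀ {p z} r → MixedPath G (p ∷ z ∷ r) → r ∈ walks p z (length r)
    walks⁺ [] _ = here refl
    walks⁺ {p} {z} (q ∷ r) (_ ∷ e@(_ ∷ eq ∷ _) , _ ∷ l@(zq ∷ _) , (_ ∷ p≢q ∷ _) ∷ u) =
      ∈-concatMap⁺ (λ q → map (q ∷_) (walks z q (length r)))
        (lose (∈-filter⁺ (λ q → ¬? (q ≟ᴱ p)) (incidents⁺ eq (Incident-sym {z} {q} zq)) (p≢q ∘ sym))
          (∈-map⁺ (q ∷_) (walks⁺ r (e , l , u))))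

    -- Only the paths with an even number 2a of elements before x; y is the element following x.
    pathsVia : Elem n → ℕ → ℕ → Elem n → List (List (Elem n))
    pathsVia x a b y = cartesianProductWith (λ l r → reverse l ++ x ∷ y ∷ r) (walks y x (double a)) (walks x y (double b))

    pathsSplit : Elem n → ℕ → ℕ → List (List (Elem n))
    pathsSplit x k a = concatMap (pathsVia x a (k ∸ a)) (incidents x)

    pathsThrough : Elem n → ℕ → List (List (Elem n))
    pathsThrough x k = concatMap (pathsSplit x k) (downFrom (suc k))

    -- Read forwards, the rest after `y` continues `x`, `y`; read backwards, the part before `x`
    -- continues `y`, `x`.
    pathsThrough⁺ : ∀ {x} a b l r → MixedPath G (l ++ x ∷ r) → length l ≡ double a → length r ≡ suc (double b) →
      l ++ x ∷ r ∈ pathsThrough x (a + b)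
    pathsThrough⁺ {x} a b l (y ∷ r) P l≡ r≡ = subst (λ l′ → l′ ++ x ∷ y ∷ r ∈ pathsThrough x (a + b)) (reverse-involutive l)
        (∈-concatMap⁺ (pathsSplit x (a + b)) (lose (∈-downFrom⁺ (s≤s (m≤m+n a b)))
          (∈-concatMap⁺ (pathsVia x a ((a + b) ∸ a)) (lose y∈
          (∈-cartesianProductWith⁺ _ before after)))))
      where
      xyr : MixedPath G (x ∷ y ∷ r)
      xyr = MixedPath-++⁻ʳ l P
      y∈ : y ∈ incidents x
      y∈ with xyr
      ... | _ ∷ ey ∷ _ , xy ∷ _ , _ = incidents⁺ ey (Incident-sym {x} {y} xy)
      after : r ∈ walks x y (double ((a + b) ∸ a))
      after = subst (λ m → r ∈ walks x y m) (trans (suc-injective r≡) (cong double (sym (m+n∸m≡n a b)))) (walks⁺ r xyr)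
      reverse≡ : reverse (l ++ x ∷ y ∷ r) ≡ reverse r ++ y ∷ x ∷ reverse l
      reverse≡ = trans (reverse-around l x (y ∷ r))
        (trans (cong (_++ x ∷ reverse l) (unfold-reverse y r)) (++-assoc (reverse r) [ y ] (x ∷ reverse l)))
      before : reverse l ∈ walks y x (double a)
      before = subst (λ m → reverse l ∈ walks y x m) (trans (length-reverse l) l≡)
        (walks⁺ (reverse l) (MixedPath-++⁻ʳ (reverse r) (subst (MixedPath G) reverse≡ (MixedPath-reverse P))))

    -- If the side before `x` is odd, then the side after it is even, and reversing the path moves
    -- that side to the front.
    pathsThrough-cover : ∀ {x} k P → MixedPath G P → length P ≡ double (suc k) → x ∈ P →
      P ∈ pathsThrough x k ⊎ reverse P ∈ pathsThrough x k
    pathsThrough-cover {x} k P mp len x∈ with ∈-∃++ x∈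
    ... | l , r , refl with split-double (length l) (length r) k (trans (sym (length-++ l)) len)
    ...   | a , b , refl , inj₁ (l≡ , r≡) = inj₁ (pathsThrough⁺ a b l r mp l≡ r≡)
    ...   | a , b , refl , inj₂ (l≡ , r≡) = inj₂ (subst₂ (λ P k → P ∈ pathsThrough x k) (sym (reverse-around l x r)) (+-comm b a)
              (pathsThrough⁺ b a (reverse r) (reverse l) (subst (MixedPath G) (reverse-around l x r) (MixedPath-reverse mp))
                (trans (length-reverse r) r≡) (trans (length-reverse l) l≡)))

    -- Bounds on the number of enumerated paths, with `d` as Δ - 1.

    module _ (d : ℕ) (degree≤ : ∀ v → degree G v ≤ suc d) where

      branching : Elem n → ℕ
      branching (vtx _)   = d
      branching (edg _ _) = 1

      incidents-length : ∀ z → length (incidents z) ≤ suc (branching z)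
      incidents-length (vtx v)   = ≤-trans (≤-reflexive (length-map (link v) (neighbours v))) (degree≤ v)
      incidents-length (edg _ _) = ≤-refl

      incidents-length-⊔ : ∀ z → length (incidents z) ≤ suc d ⊔ 2
      incidents-length-⊔ z@(vtx _)   = ≤-trans (incidents-length z) (m≤m⊔n (suc d) 2)
      incidents-length-⊔ z@(edg _ _) = m≤n⊔m (suc d) 2

      -- `p` is itself among the elements incident with `z`, so filtering it out saves one.
      next-length : ∀ {p z} → IsElem G p → Incident p z → length (next p z) ≤ branching z
      next-length {p} {z} ep pz = ≤-pred (≤-trans
        (filter-notAll (λ q → ¬? (q ≟ᴱ p)) (incidents z) (lose (incidents⁺ ep pz) λ p≢p → p≢p refl)) (incidents-length z))

      -- The branching at the elements incident with `z`, which are of the other kind. Two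
      -- consecutive steps therefore offer at most `d` choices together, whichever kind comes first.
      branching′ : Elem n → ℕ
      branching′ (vtx _)   = 1
      branching′ (edg _ _) = d

      branching-* : ∀ z → branching z * branching′ z ≡ d
      branching-* (vtx _)   = *-identityʳ d
      branching-* (edg _ _) = *-identityˡ d

      branching-incident : ∀ {z q} → Incident z q → branching q ≡ branching′ z
      branching-incident {vtx _} {edg _ _} _ = refl
      branching-incident {edg _ _} {vtx _} _ = refl

      walks-suc-length : ∀ {p z} m {c} → IsElem G p → IsElem G z → Incident p z →
        (∀ {q} → IsElem G q → Incident z q → length (walks z q m) ≤ c) → length (walks p z (suc m)) ≤ branching z * c
      walks-suc-length {p} {z} m {c} ep ez pz h = ≤-trans
        (length-concatMap-≤ (λ q → map (q ∷_) (walks z q m)) (next p z) λ {q} q∈ →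
          let eq , zq = incidents⁻ z ez (proj₁ (∈-filter⁻ (λ q → ¬? (q ≟ᴱ p)) q∈))
          in subst (_≤ c) (sym (length-map (q ∷_) (walks z q m))) (h eq zq))
        (*-monoˡ-≤ c (next-length ep pz))

      walks-length : ∀ {p z} a → IsElem G p → IsElem G z → Incident p z → length (walks p z (double a)) ≤ d ^ a
      walks-length zero _ _ _ = ≤-refl
      walks-length {p} {z} (suc a) ep ez pz = ≤-trans
        (walks-suc-length (suc (double a)) ep ez pz λ {q} eq zq → ≤-trans
          (walks-suc-length (double a) ez eq zq λ eq′ qq′ → walks-length a eq eq′ qq′)
          (≤-reflexive (cong (_* d ^ a) (branching-incident {z} {q} zq))))
        (≤-reflexive (trans (sym (*-assoc (branching z) _ _)) (cong (_* d ^ a) (branching-* z))))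

      -- There are `suc k` values of `a`, at most `suc d ⊔ 2` choices of `y` (an edge has two ends),
      -- and at most `d ^ a` and `d ^ (k ∸ a)` walks on the two sides. Since `y` is chosen
      -- separately, both walks have even length, and their bounds multiply to `d ^ k`.
      pathsThrough-length : ∀ {x} k → IsElem G x → length (pathsThrough x k) ≤ suc k * ((suc d ⊔ 2) * d ^ k)
      pathsThrough-length {x} k ex = subst (λ m → length (pathsThrough x k) ≤ m * ((suc d ⊔ 2) * d ^ k))
        (length-downFrom (suc k))
        (length-concatMap-≤ (pathsSplit x k) (downFrom (suc k)) λ {a} a∈ → ≤-trans
          (length-concatMap-≤ (pathsVia x a (k ∸ a)) {d ^ k} (incidents x) λ {y} y∈ → through a (≤-pred (∈-downFrom⁻ a∈)) y∈)
          (*-monoˡ-≤ (d ^ k) (incidents-length-⊔ x)))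
        where
        open ≤-Reasoning
        through : ∀ a {y} → a ≤ k → y ∈ incidents x →
          length (pathsVia x a (k ∸ a) y) ≤ d ^ k
        through a {y} a≤k y∈ with incidents⁻ x ex y∈
        ... | ey , xy = begin
          length (pathsVia x a (k ∸ a) y)
            ≡⟨ length-cartesianProductWith _ (walks y x (double a)) _ ⟩
          length (walks y x (double a)) * length (walks x y (double (k ∸ a)))
            ≤⟨ *-mono-≤ (walks-length a ey ex (Incident-sym {x} {y} xy)) (walks-length (k ∸ a) ex ey xy) ⟩
          d ^ a * d ^ (k ∸ a)
            ≡⟨ sym (^-distribˡ-+-* d a (k ∸ a)) ⟩
          d ^ (a + (k ∸ a))
            ≡⟨ cong (d ^_) (m+[n∸m]≡n a≤k) ⟩
          d ^ k ∎

-- From the counting argument to graph colourings.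

-- A square in the colour sequence lifts to adjacent segments `A`, `B` of equal length, and a
-- consecutive segment of a mixed path is again a mixed path.
noTwins⇒weakTotalThue : ∀ {n} (G : Graph n) {c : Elem n → ℕ} →
  (∀ k A B → length A ≡ suc k → length B ≡ suc k → MixedPath G (A ++ B) → map c A ≢ map c B) → WeakTotalThue G c
noTwins⇒weakTotalThue G noTwins P mp pre _ suf eq ([] , ys≢[] , refl) = ys≢[] refl
noTwins⇒weakTotalThue G {c} noTwins P mp pre _ suf eq (y ∷ ys , _ , refl) with map-≡-++ c P pre eq
... | P₁ , R , refl , _ , eR with map-≡-++ c R ((y ∷ ys) ++ (y ∷ ys)) eR
...   | Q , P₂ , refl , eQ , _ with map-≡-++ c Q (y ∷ ys) eQ
...     | A , B , refl , eA , eB =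
  noTwins (length ys) A B (half-length A eA) (half-length B eB)
    (MixedPath-++⁻ˡ G (A ++ B) {P₂} (MixedPath-++⁻ʳ G P₁ mp)) (trans eA (sym eB))
  where
  half-length : ∀ H → map c H ≡ y ∷ ys → length H ≡ suc (length ys)
  half-length H eH = trans (sym (length-map c H)) (cong length eH)

weakTotalThueChoosable : ∀ n (G : Graph n) d → (∀ v → degree G v ≤ suc d) → WeakTotalThueChoosable G (6 * suc d)
weakTotalThueChoosable n G d degree≤ L L-ok =
    f ∘ encode , (λ x ex → subst (f (encode x) ∈_) (cong L (decode-encode x)) (f∈ (S⁺ ex))) , noTwins⇒weakTotalThue G noTwins
  where
  N = n + n * n
  Path : List (Fin N) → Set
  Path Q = MixedPath G (map decode Q)
  halves : ℕ → List (Elem n) → List (Fin N) × List (Fin N)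
  halves k P = take (suc k) (map encode P) , drop (suc k) (map encode P)
  halves≡ : ∀ k A B → length A ≡ suc k → halves k (map decode (A ++ B)) ≡ (A , B)
  halves≡ k A B lA = trans (cong (λ Q → take (suc k) Q , drop (suc k) Q)
      (trans (sym (map-∘ (A ++ B))) (trans (map-cong-local (All.tabulate λ {i} _ → encode-decode {n} i)) (map-id (A ++ B)))))
    (cong₂ _,_ (take-length-++ A lA) (drop-length-++ A lA))
  pairs : Fin N → ℕ → List (List (Fin N) × List (Fin N))
  pairs i k = map (halves k) (pathsThrough G (decode i) k)
  cover : ∀ {i} k A B → length A ≡ suc k → length B ≡ suc k → Path (A ++ B) → i ∈ A ++ B →
    (A , B) ∈ pairs i k ⊎ (reverse B , reverse A) ∈ pairs i k
  cover {i} k A B lA lB p i∈ with pathsThrough-cover G k (map decode (A ++ B)) p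
    (trans (length-map (decode {n}) (A ++ B)) (trans (length-++ A {B}) (trans (cong₂ _+_ lA lB) (n+n≡double (suc k)))))
    (∈-map⁺ (decode {n}) i∈)
  ... | inj₁ P∈ = inj₁ (subst (_∈ pairs i k) (halves≡ k A B lA) (∈-map⁺ (halves k) P∈))
  ... | inj₂ P∈ = inj₂ (subst (_∈ pairs i k)
          (trans (cong (halves k) (trans (sym (reverse-map decode (A ++ B))) (cong (map decode) (reverse-++ A B))))
            (halves≡ k (reverse B) (reverse A) (trans (length-reverse B) lB)))
          (∈-map⁺ (halves k) P∈))
  open Counting (IsElem G ∘ decode) (L ∘ decode) Path (λ Q → mixedPath? G (map decode Q))
    (λ (_ , _ , u) → Unique.map⁻ u)
    (λ {Q} p → subst (MixedPath G) (sym (reverse-map decode Q)) (MixedPath-reverse G p))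
    -- Growth factor 2Δ, list size 6Δ, and as weights the bounds on the number of paths through an
    -- element.
    pairs cover (2 * suc d) (6 * suc d) (λ k → suc k * ((suc d ⊔ 2) * d ^ k)) (s≤s z≤n)
    (λ e → proj₁ (L-ok _ e)) (λ e → proj₂ (L-ok _ e))
    (λ {i} e k → subst (_≤ suc k * ((suc d ⊔ 2) * d ^ k)) (sym (length-map (halves k) (pathsThrough G (decode i) k)))
      (pathsThrough-length G d degree≤ k e))
    (budget d N)
  isElemAt? : ∀ i → Dec (IsElem G (decode i))
  isElemAt? i = isElem? G (decode i)
  -- The codes of all vertices and edges, so a clean colouring of `S` colours the whole graph.
  S = filter isElemAt? (allFin N)
  S⁺ : ∀ {x} → IsElem G x → encode x ∈ S
  S⁺ {x} ex = ∈-filter⁺ isElemAt? (∈-allFin (encode x)) (subst (IsElem G) (sym (decode-encode x)) ex)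
  colouring = clean-colouring S (Unique.filter⁺ isElemAt? (Unique.allFin⁺ N)) (All.all-filter isElemAt? (allFin N))
  f = proj₁ colouring
  f∈ = proj₁ (proj₂ colouring)
  clean = proj₂ (proj₂ colouring)
  noTwins : ∀ k A B → length A ≡ suc k → length B ≡ suc k → MixedPath G (A ++ B) → map (f ∘ encode) A ≢ map (f ∘ encode) B
  noTwins k A B lA lB mp eq = clean k (map encode A) (map encode B)
    ( trans (length-map encode A) lA , trans (length-map encode B) lB , subst (MixedPath G) (sym decoded) mp
    , subst (All (_∈ S)) (map-++ encode A B) (All.map⁺ (All.map S⁺ (proj₁ mp)))
    , trans (sym (map-∘ A)) (trans eq (map-∘ B)))
    where
    decoded : map decode (map encode A ++ map encode B) ≡ A ++ B
    decoded = trans (cong (map decode) (sym (map-++ encode A B))) (trans (sym (map-∘ (A ++ B)))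
      (trans (map-cong-local (All.tabulate λ {x} _ → decode-encode x)) (map-id (A ++ B))))

theorem3 : ∀ (n : ℕ) (G : Graph n) (Δ : ℕ) → MaxDegree G Δ → 1 ≤ Δ →
    WeakTotalThueChoosable G (6 * Δ)
theorem3 n G (suc d) (degree≤ , _) _ = weakTotalThueChoosable n G d degree≤
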